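{- Let $(G,R)$ and $(G',R')$ be cyclically ordered groups, with Rieger unwounds $(uw(G),\leq_R)$ and $(uw(G'),\leq_{R'})$ and distinguished elements $z_G=(1,e)$, $z_{G'}=(1,e')$. Then $(G,R)\equiv(G',R')$ in the language $L_c=\{\cdot,R,e,^{ -1}\}$ if and only if $(uw(G),\leq_R,z_G)\equiv(uw(G'),\leq_{R'},z_{G'})$ in the language of ordered groups with one additional constant symbol (interpreted by $z_G$, resp. $z_{G'}$). The same holds for elementary inclusion: if $(G,R)$ is a substructure of $(G',R')$ (so that $uw(G)$ is canonically a substructure of $uw(G')$ and $z_G=z_{G'}$), then $(G,R)$ is an elementary substructure of $(G',R')$ if and only if $(uw(G),\leq_R,z_G)$ is an elementary substructure of $(uw(G'),\leq_{R'},z_{G'})$.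
   Context: A cyclic order on a set $A$ is a ternary relation $R$ such that: $R(x,y,z)$ implies $x,y,z$ pairwise distinct; for pairwise distinct $x,y,z$, $R(x,y,z)$ or $R(x,z,y)$; $R(x,y,z)\Rightarrow R(y,z,x)$; $R(x,y,z)$ and $R(y,u,z)$ imply $R(x,u,z)$. A cyclically ordered group (c.o.g.) $(G,R)$ is a group $G$ with identity $e$ and a cyclic order $R$ on $G$ such that $R(x,y,z)\Rightarrow R(uxv,uyv,uzv)$ for all $u,v$. The Rieger unwound $uw(G)$ of a c.o.g. $(G,R)$ is the set $\mathbb{Z}\times G$ with the order $(m,g)\leq_R(m',g')$ iff $(m,g)=(m',g')$ or $m<m'$ or ($m=m'$ and ($R(e,g,g')$ or $g=e$)), and the group law: $(k,e)\cdot(m,h)=(k+m,h)$, $(k,g)\cdot(m,e)=(k+m,g)$, and for $g,h\neq e$: $(k,g)\cdot(m,h)=(k+m,gh)$ if $R(e,g,gh)$, $=(k+m+1,gh)$ if $R(e,gh,g)$, $=(k+m+1,e)$ if $gh=e$. This is a totally ordered group in which $z_G=(1,e)$ is central and cofinal, and $uw(G)/\langle z_G\rangle\cong G$. -}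

module Defs where

open import Data.Nat using (ℕ; zero; suc)
open import Data.Fin using (Fin; zero; suc)
open import Data.Integer as ℤ using (ℤ; 1ℤ; 0ℤ) renaming (_+_ to _+ℤ_; _<_ to _<ℤ_; -_ to -ℤ_)
open import Data.Product using (_×_; _,_; proj₁; proj₂)
open import Data.Sum using (_⊎_)
open import Data.Empty using (⊥)
open import Function using (_∘_)
open import Function.Bundles using (_⇔_)
open import Relation.Nullary using (¬_; Dec; yes; no)
open import Relation.Binary.PropositionalEquality using (_≡_; _≢_)
open import Algebra.Structures using (IsGroup)

-- Classical logic (excluded middle), taken as an explicit hypothesis
-- since first-order model theory (Tarski semantics) is classical.

LEM : Set₁
LEM = (A : Set) → Dec A

record Language : Set₁ where
  field
    Fun : ℕ → Set
    Rel : ℕ → Set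

module _ (L : Language) where
  open Language L

  data Term (n : ℕ) : Set where
    var : Fin n → Term n
    app : ∀ {k} → Fun k → (Fin k → Term n) → Term n

  data Formula : ℕ → Set where
    _≐_  : ∀ {n} → Term n → Term n → Formula n
    rel  : ∀ {n k} → Rel k → (Fin k → Term n) → Formula n
    ⊥f   : ∀ {n} → Formula n
    _⇒f_ : ∀ {n} → Formula n → Formula n → Formula n
    _∧f_ : ∀ {n} → Formula n → Formula n → Formula n
    _∨f_ : ∀ {n} → Formula n → Formula n → Formula n
    ∀f   : ∀ {n} → Formula (suc n) → Formula n
    ∃f   : ∀ {n} → Formula (suc n) → Formula n

  record Structure : Set₁ where
    field
      Carrier : Set
      funI    : ∀ {k} → Fun k → (Fin k → Carrier) → Carrier
      relI    : ∀ {k} → Rel k → (Fin k → Carrier) → Set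

module _ {L : Language} (M : Structure L) where
  open Structure M

  extend : ∀ {n} → Carrier → (Fin n → Carrier) → Fin (suc n) → Carrier
  extend a ρ zero    = a
  extend a ρ (suc i) = ρ i

  eval : ∀ {n} → (Fin n → Carrier) → Term L n → Carrier
  eval ρ (var i)    = ρ i
  eval ρ (app f ts) = funI f (λ i → eval ρ (ts i))

  Sat : ∀ {n} → Formula L n → (Fin n → Carrier) → Set
  Sat (t ≐ u)    ρ = eval ρ t ≡ eval ρ u
  Sat (rel r ts) ρ = relI r (λ i → eval ρ (ts i))
  Sat ⊥f         ρ = ⊥
  Sat (φ ⇒f ψ)   ρ = Sat φ ρ → Sat ψ ρ
  Sat (φ ∧f ψ)   ρ = Sat φ ρ × Sat ψ ρ
  Sat (φ ∨f ψ)   ρ = Sat φ ρ ⊎ Sat ψ ρ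
  Sat (∀f φ)     ρ = (a : Carrier) → Sat φ (extend a ρ)
  Sat (∃f φ)     ρ = Data.Product.Σ Carrier (λ a → Sat φ (extend a ρ))

noVars : {A : Set} → Fin 0 → A
noVars ()

ElemEquiv : {L : Language} → Structure L → Structure L → Set
ElemEquiv {L} M N = (φ : Formula L 0) → Sat M φ noVars ⇔ Sat N φ noVars

-- f : M → N is elementary: every formula under every assignment is
-- preserved and reflected.  For an inclusion of a substructure this is
-- "M is an elementary substructure of N".
IsElementary : {L : Language} (M N : Structure L) →
               (Structure.Carrier M → Structure.Carrier N) → Set
IsElementary {L} M N f =
  ∀ {n} (φ : Formula L n) (ρ : Fin n → Structure.Carrier M) →
  Sat M φ ρ ⇔ Sat N φ (f ∘ ρ)

record COG : Set₁ where
  infixl 7 _∙_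
  field
    Carrier : Set
    _∙_     : Carrier → Carrier → Carrier
    e       : Carrier
    _⁻¹     : Carrier → Carrier
    isGroup : IsGroup _≡_ _∙_ e _⁻¹
    R       : Carrier → Carrier → Carrier → Set
    R-distinct : ∀ {x y z} → R x y z → (x ≢ y) × (y ≢ z) × (x ≢ z)
    R-total    : ∀ {x y z} → x ≢ y → y ≢ z → x ≢ z → R x y z ⊎ R x z y
    R-cyclic   : ∀ {x y z} → R x y z → R y z x
    R-trans    : ∀ {x y z u} → R x y z → R y u z → R x u z
    R-compat   : ∀ {x y z} → R x y z → ∀ u v →
                 R (u ∙ x ∙ v) (u ∙ y ∙ v) (u ∙ z ∙ v)

data FunC : ℕ → Set where
  mulC : FunC 2
  invC : FunC 1
  oneC : FunC 0

data RelC : ℕ → Set where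
  cycR : RelC 3

Lc : Language
Lc = record { Fun = FunC ; Rel = RelC }

cogStr : COG → Structure Lc
cogStr G = record { Carrier = Carrier ; funI = fI ; relI = rI }
  where
  open COG G
  fI : ∀ {k} → FunC k → (Fin k → Carrier) → Carrier
  fI mulC a = a zero ∙ a (suc zero)
  fI invC a = a zero ⁻¹
  fI oneC a = e
  rI : ∀ {k} → RelC k → (Fin k → Carrier) → Set
  rI cycR a = R (a zero) (a (suc zero)) (a (suc (suc zero)))

data FunO : ℕ → Set where
  mulO  : FunO 2
  invO  : FunO 1
  oneO  : FunO 0
  zO    : FunO 0

data RelO : ℕ → Set where
  leqO : RelO 2

Loz : Language
Loz = record { Fun = FunO ; Rel = RelO }

module Unwound (lem : LEM) (G : COG) where
  open COG G

  UW : Set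
  UW = ℤ × Carrier

  _≤uw_ : UW → UW → Set
  (m , g) ≤uw (m' , g') =
    ((m , g) ≡ (m' , g')) ⊎ (m <ℤ m') ⊎ ((m ≡ m') × (R e g g' ⊎ g ≡ e))

  _·uw_ : UW → UW → UW
  (k , g) ·uw (m , h) with lem (g ≡ e)
  ... | yes _ = (k +ℤ m , h)
  ... | no _ with lem (h ≡ e)
  ...   | yes _ = (k +ℤ m , g)
  ...   | no _ with lem (g ∙ h ≡ e)
  ...     | yes _ = (k +ℤ m +ℤ 1ℤ , e)
  ...     | no _ with lem (R e g (g ∙ h))
  ...       | yes _ = (k +ℤ m , g ∙ h)
  ...       | no _  = (k +ℤ m +ℤ 1ℤ , g ∙ h)

  invuw : UW → UW
  invuw (m , g) with lem (g ≡ e)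
  ... | yes _ = (-ℤ m , e)
  ... | no _  = (-ℤ m +ℤ -ℤ 1ℤ , g ⁻¹)

  uwStr : Structure Loz
  uwStr = record { Carrier = UW ; funI = fI ; relI = rI }
    where
    fI : ∀ {k} → FunO k → (Fin k → UW) → UW
    fI mulO a = a zero ·uw a (suc zero)
    fI invO a = invuw (a zero)
    fI oneO a = (0ℤ , e)
    fI zO   a = (1ℤ , e)
    rI : ∀ {k} → RelO k → (Fin k → UW) → Set
    rI leqO a = a zero ≤uw a (suc zero)

open Unwound public using (uwStr)

-- (G,R) is a substructure of (G',R') via ι (an L_c-embedding)

record IsCOGEmbedding (G G' : COG) (ι : COG.Carrier G → COG.Carrier G') : Set where
  private
    module G  = COG G
    module G' = COG G'
  field
    injective : ∀ {x y} → ι x ≡ ι y → x ≡ y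
    pres-∙    : ∀ x y → ι (x G.∙ y) ≡ ι x G'.∙ ι y
    pres-e    : ι G.e ≡ G'.e
    pres-⁻¹   : ∀ x → ι (x G.⁻¹) ≡ (ι x) G'.⁻¹
    pres-R    : ∀ x y z → G.R x y z ⇔ G'.R (ι x) (ι y) (ι z)

uwMap : (G G' : COG) → (COG.Carrier G → COG.Carrier G') →
        ℤ × COG.Carrier G → ℤ × COG.Carrier G'
uwMap G G' ι (m , g) = (m , ι g)

{-# OPTIONS --safe #-}
-- Each direction translates formulas uniformly in the group, so that elementary
-- equivalence and elementarity are transferred together.
--
-- (G,R) is interpreted in uw(G) on the interval [1,z), an element g being coded
-- by (0,g): products and inverses are computed in uw(G) and brought back to the
-- interval by dividing by z when necessary, and R(x,y,w) is read off the order
-- as R(e,x⁻¹y,x⁻¹w).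
--
-- Conversely uw(G) is interpreted without quantifiers in the disjoint union of ℤ
-- and G, the carry of the addition depending only on the G-coordinates.  In the
-- manner of Feferman and Vaught, a formula about elements (kᵢ,gᵢ) becomes a
-- finite decision tree that asks L_c-questions about the gᵢ and whose leaves are
-- predicates of the kᵢ.  Since ℤ is common to all unwounds, these predicates
-- need not be definable.
module Submission where

open import Defs
open import Level using (Level)
open import Data.Bool using (if_then_else_)
open import Data.Empty using (⊥; ⊥-elim)
open import Data.Fin using (Fin; zero; suc)
open import Data.Integer using (ℤ; 0ℤ; 1ℤ; +<+) renaming (_+_ to _+ℤ_; -_ to -ℤ_; _<_ to _<ℤ_)
import Data.Integer.Properties as ℤ
open import Data.Nat using (ℕ; suc)
open import Data.Product using (_×_; _,_; Σ; proj₁; proj₂)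
open import Data.Product.Function.NonDependent.Propositional using (_×-⇔_)
open import Data.Sum using (_⊎_; inj₁; inj₂; [_,_]′)
open import Data.Sum.Function.Propositional using (_⊎-⇔_)
open import Data.Unit using (⊤)
open import Data.Vec.Functional using (_∷_; [])
open import Function using (_∘_; id)
open import Function.Bundles using (_⇔_; mk⇔; module Equivalence)
open import Function.Construct.Composition using (_⇔-∘_)
open import Function.Construct.Identity using (⇔-id)
open import Function.Construct.Symmetry using (⇔-sym)
open import Function.Related.TypeIsomorphisms using (→-cong-⇔)
open import Relation.Nullary using (¬_; yes; no; does)
open import Relation.Binary.PropositionalEquality
  using (_≡_; _≢_; refl; sym; trans; cong; cong₂; cong-app; subst; subst₂)
open import Algebra.Bundles using (Group)
import Algebra.Properties.Group as GroupProperties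

open Equivalence using (to; from)

-- Preliminaries on equivalences and integers

private
  variable
    n : ℕ
    a b c : Level

infixr 0 _⇔∘_

_⇔∘_ : {A : Set a} {B : Set b} {C : Set c} → A ⇔ B → B ⇔ C → A ⇔ C
f ⇔∘ g = g ⇔-∘ f

¬f_ : {L : Language} → Formula L n → Formula L n
¬f φ = φ ⇒f ⊥f

≡-cong-⇔ : {A : Set a} {x x′ y y′ : A} → x ≡ x′ → y ≡ y′ → (x ≡ y) ⇔ (x′ ≡ y′)
≡-cong-⇔ refl refl = ⇔-id _

,-injective-⇔ : {A : Set a} {B : Set b} {x : A} {y y′ : B} → ((x , y) ≡ (x , y′)) ⇔ (y ≡ y′)
,-injective-⇔ = mk⇔ (cong proj₂) (cong (_ ,_))

0≤k<1⇒k≡0 : ∀ {k} → (0ℤ ≡ k) ⊎ (0ℤ <ℤ k) → ¬ (1ℤ <ℤ k) → ¬ (1ℤ ≡ k) → 0ℤ ≡ k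
0≤k<1⇒k≡0 (inj₁ 0≡k) _ _ = 0≡k
0≤k<1⇒k≡0 (inj₂ 0<k) 1≮k 1≢k = ⊥-elim (1≮k (ℤ.≤∧≢⇒< (ℤ.i<j⇒suc[i]≤j 0<k) 1≢k))

-- Translations in cyclically ordered groups

module COGProperties (G : COG) where
  open COG G public

  group : Group _ _
  group = record { isGroup = isGroup }

  open Group group public using (identityˡ; identityʳ; inverseˡ)
  open GroupProperties group public using (ε⁻¹≈ε; \\-leftDividesˡ)

  R-resp : ∀ {x x′ y y′ z z′} → x ≡ x′ → y ≡ y′ → z ≡ z′ → R x y z → R x′ y′ z′
  R-resp refl refl refl r = r

  R-translate : ∀ {x y z} u → R x y z → R (u ∙ x) (u ∙ y) (u ∙ z)
  R-translate u r =
    R-resp (identityʳ _) (identityʳ _) (identityʳ _) (R-compat r u e)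

  -- Translating by `x ⁻¹` carries `x` to `e`, and translating by `x` undoes it. The order of the
  -- unwound only mentions triples that start at `e`, hence this normal form.
  R-based : ∀ x y z → R x y z ⇔ R e (x ⁻¹ ∙ y) (x ⁻¹ ∙ z)
  R-based x y z = mk⇔
    (R-resp (inverseˡ x) refl refl ∘ R-translate (x ⁻¹))
    (R-resp (identityʳ x) (\\-leftDividesˡ x y) (\\-leftDividesˡ x z) ∘ R-translate x)

-- Multiplication and order in the unwound

module UnwoundProperties (lem : LEM) (G : COG) where
  open COGProperties G
  open Unwound lem G using (_·uw_; invuw; _≤uw_)

  ·uw-integerˡ : ∀ k m h → (k , e) ·uw (m , h) ≡ (k +ℤ m , h)
  ·uw-integerˡ k m h with lem (e ≡ e)
  ... | yes _ = refl
  ... | no ne = ⊥-elim (ne refl)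

  ·uw-integerʳ : ∀ k g m → (k , g) ·uw (m , e) ≡ (k +ℤ m , g)
  ·uw-integerʳ k g m with lem (g ≡ e)
  ... | yes g≡e = cong (k +ℤ m ,_) (sym g≡e)
  ... | no _ with lem (e ≡ e)
  ...   | yes _ = refl
  ...   | no ne = ⊥-elim (ne refl)

  -- The carry is at most one, so a product of two elements of [1,z) returns to the interval after
  -- at most one division by z.
  ·uw-interval : ∀ g h → ((0ℤ , g) ·uw (0ℤ , h) ≡ (0ℤ , g ∙ h)) ⊎
                         ((0ℤ , g) ·uw (0ℤ , h) ≡ (1ℤ , g ∙ h))
  ·uw-interval g h with lem (g ≡ e)
  ... | yes g≡e = inj₁ (cong (0ℤ ,_) (sym (trans (cong (_∙ h) g≡e) (identityˡ h))))
  ... | no _ with lem (h ≡ e)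
  ...   | yes h≡e = inj₁ (cong (0ℤ ,_) (sym (trans (cong (g ∙_) h≡e) (identityʳ g))))
  ...   | no _ with lem (g ∙ h ≡ e)
  ...     | yes gh≡e = inj₂ (cong (1ℤ ,_) (sym gh≡e))
  ...     | no _ with lem (R e g (g ∙ h))
  ...       | yes _ = inj₁ refl
  ...       | no _  = inj₂ refl

  -- For `g ≢ e` the inverse has ℤ-coordinate -1, which the factor z cancels. For `g ≡ e` the result
  -- is z itself, just outside [1,z), so inverses too may need one division.
  invuw-interval : ∀ g → ((1ℤ , e) ·uw invuw (0ℤ , g) ≡ (0ℤ , g ⁻¹)) ⊎
                         ((1ℤ , e) ·uw invuw (0ℤ , g) ≡ (1ℤ , g ⁻¹))
  invuw-interval g with lem (g ≡ e)
  ... | yes g≡e = inj₂ (trans (·uw-integerˡ _ _ _)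
                              (cong (1ℤ ,_) (sym (trans (cong _⁻¹ g≡e) ε⁻¹≈ε))))
  ... | no _ = inj₁ (·uw-integerˡ _ _ _)

  invuw-integer : ∀ k → invuw (k , e) ≡ (-ℤ k , e)
  invuw-integer k with lem (e ≡ e)
  ... | yes _ = refl
  ... | no ne = ⊥-elim (ne refl)

  z≰interval : ∀ g → ¬ ((1ℤ , e) ≤uw (0ℤ , g))
  z≰interval g (inj₁ ())
  z≰interval g (inj₂ (inj₁ (+<+ ())))
  z≰interval g (inj₂ (inj₂ (() , _)))

  -- No integer lies strictly between 0 and 1. This makes the codes (0,g) a definable set, to which
  -- quantifiers can be relativised.
  interval⇒zero : ∀ k g → (0ℤ , e) ≤uw (k , g) → ¬ ((1ℤ , e) ≤uw (k , g)) → 0ℤ ≡ k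
  interval⇒zero k g 0≤ 1≰ = 0≤k<1⇒k≡0
    ([ inj₁ ∘ cong proj₁ , [ inj₂ , inj₁ ∘ proj₁ ]′ ]′ 0≤)
    (1≰ ∘ inj₂ ∘ inj₁)
    (λ 1≡k → 1≰ (inj₂ (inj₂ (1≡k , inj₂ refl))))

  -- Strictness and g ≢ e are what removes the degenerate clauses of _≤uw_.
  R-from-≤uw : ∀ g h → R e g h ⇔
    (((0ℤ , g) ≤uw (0ℤ , h)) × ((0ℤ , g) ≢ (0ℤ , h)) × ((0ℤ , g) ≢ (0ℤ , e)))
  R-from-≤uw g h = mk⇔ there back
    where
    there : R e g h → _
    there r = inj₂ (inj₂ (refl , inj₁ r)) ,
              proj₁ (proj₂ (R-distinct r)) ∘ cong proj₂ ,
              proj₁ (R-distinct r) ∘ sym ∘ cong proj₂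
    back : _ → R e g h
    back (inj₁ p , ne , _) = ⊥-elim (ne p)
    back (inj₂ (inj₁ (+<+ ())) , _)
    back (inj₂ (inj₂ (_ , inj₁ r)) , _) = r
    back (inj₂ (inj₂ (_ , inj₂ g≡e)) , _ , ne) = ⊥-elim (ne (cong (0ℤ ,_) g≡e))

-- Interpretation of G in its unwound

infixl 7 _⊗_ _⊗ᶜ_
infix 4 _≤ᶠ_

_⊗_ : Term Loz n → Term Loz n → Term Loz n
a ⊗ b = app mulO (a ∷ b ∷ [])

invᵗ : Term Loz n → Term Loz n
invᵗ a = app invO (a ∷ [])

oneᵗ zᵗ : Term Loz n
oneᵗ = app oneO []
zᵗ = app zO []

_≤ᶠ_ : Term Loz n → Term Loz n → Formula Loz n
a ≤ᶠ b = rel leqO (a ∷ b ∷ [])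

_⊗ᶜ_ : Term Lc n → Term Lc n → Term Lc n
t ⊗ᶜ u = app mulC (t ∷ u ∷ [])

invᶜ : Term Lc n → Term Lc n
invᶜ t = app invC (t ∷ [])

-- The term denoting the representative in [1,z) depends on the assignment, so
-- terms are translated in continuation-passing style.
Context : ℕ → Set
Context n = (Term Loz n → Formula Loz n) → Formula Loz n

-- A disjunction of two mutually exclusive guarded cases plays the role of a conditional term.
reduce : Term Loz n → Context n
reduce a K = ((zᵗ ≤ᶠ a) ∧f K (a ⊗ invᵗ zᵗ)) ∨f ((¬f (zᵗ ≤ᶠ a)) ∧f K a)

represent : Term Lc n → Context n
represent (var i) K = K (var i)
represent (app mulC ts) K =
  represent (ts zero) λ a → represent (ts (suc zero)) λ b → reduce (a ⊗ b) K
represent (app invC ts) K = represent (ts zero) λ a → reduce (zᵗ ⊗ invᵗ a) K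
represent (app oneC ts) K = K oneᵗ

inInterval : Term Loz n → Formula Loz n
inInterval a = (oneᵗ ≤ᶠ a) ∧f (¬f (zᵗ ≤ᶠ a))

based : Term Loz n → Term Loz n → Formula Loz n
based a b = (a ≤ᶠ b) ∧f ((¬f (a ≐ b)) ∧f (¬f (a ≐ oneᵗ)))

wind : Formula Lc n → Formula Loz n
wind (t ≐ u) = represent t λ a → represent u λ b → a ≐ b
wind (rel cycR ts) =
  -- The quotients are formed as L_c-terms, so that `represent` brings them back to [1,z) before
  -- they are compared.
  represent (invᶜ (ts zero) ⊗ᶜ ts (suc zero)) λ a →
  represent (invᶜ (ts zero) ⊗ᶜ ts (suc (suc zero))) (based a)
wind ⊥f = ⊥f
wind (φ ⇒f ψ) = wind φ ⇒f wind ψ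
wind (φ ∧f ψ) = wind φ ∧f wind ψ
wind (φ ∨f ψ) = wind φ ∨f wind ψ
wind (∀f φ) = ∀f (inInterval (var zero) ⇒f wind φ)
wind (∃f φ) = ∃f (inInterval (var zero) ∧f wind φ)

-- Correctness of the interpretation on [1,z)

module WindCorrect (lem : LEM) (G : COG) where
  open COGProperties G
  open Unwound lem G using (UW; _·uw_; invuw; _≤uw_)
  open UnwoundProperties lem G

  private
    M = cogStr G
    U = uwStr lem G

  -- The term may depend on the assignment although `T` does not. Asking for agreement at every `K`
  -- is what allows contexts to be nested.
  Represents : (Fin n → UW) → Context n → Carrier → Set
  Represents σ T g = Σ (Term Loz _) λ a →
    (eval U σ a ≡ (0ℤ , g)) × (∀ K → Sat U (T K) σ ⇔ Sat U (K a) σ)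

  reduce-correct : ∀ {σ : Fin n → UW} (a : Term Loz n) g →
    (eval U σ a ≡ (0ℤ , g)) ⊎ (eval U σ a ≡ (1ℤ , g)) → Represents σ (reduce a) g
  reduce-correct {σ = σ} a g (inj₁ a≡) = a , a≡ , λ K → mk⇔
    [ ⊥-elim ∘ z≰a ∘ proj₁ , proj₂ ]′
    (λ s → inj₂ (z≰a , s))
    where
    z≰a : ¬ ((1ℤ , e) ≤uw eval U σ a)
    z≰a = z≰interval g ∘ subst ((1ℤ , e) ≤uw_) a≡
  reduce-correct {σ = σ} a g (inj₂ a≡) = a ⊗ invᵗ zᵗ , value , λ K → mk⇔
    [ proj₂ , (λ p → ⊥-elim (proj₁ p z≤a)) ]′
    (λ s → inj₁ (z≤a , s))
    where
    z≤a : (1ℤ , e) ≤uw eval U σ a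
    z≤a = subst ((1ℤ , e) ≤uw_) (sym a≡) (inj₂ (inj₂ (refl , inj₂ refl)))
    -- The inverse of z is (-1,e), and multiplication by a power of z produces no carry.
    value : eval U σ a ·uw invuw (1ℤ , e) ≡ (0ℤ , g)
    value = trans (cong₂ _·uw_ a≡ (invuw-integer 1ℤ)) (·uw-integerʳ _ _ _)

  represent-correct : ∀ (t : Term Lc n) {σ gs} → (∀ i → σ i ≡ (0ℤ , gs i)) →
    Represents σ (represent t) (eval M gs t)
  represent-correct (var i) σ≡ = var i , σ≡ i , λ K → ⇔-id _
  represent-correct (app mulC ts) σ≡
    with represent-correct (ts zero) σ≡ | represent-correct (ts (suc zero)) σ≡
  ... | a , a≡ , A | b , b≡ , B
    with reduce-correct (a ⊗ b) _
           (subst (λ x → (x ≡ _) ⊎ (x ≡ _)) (sym (cong₂ _·uw_ a≡ b≡)) (·uw-interval _ _))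
  ... | c , c≡ , C = c , c≡ , λ K → A _ ⇔∘ B _ ⇔∘ C K
  represent-correct (app invC ts) σ≡ with represent-correct (ts zero) σ≡
  ... | a , a≡ , A
    with reduce-correct (zᵗ ⊗ invᵗ a) _
           (subst (λ x → (x ≡ _) ⊎ (x ≡ _))
                  (sym (cong (λ x → (1ℤ , e) ·uw invuw x) a≡)) (invuw-interval _))
  ... | c , c≡ , C = c , c≡ , λ K → A _ ⇔∘ C K
  represent-correct (app oneC ts) σ≡ = oneᵗ , refl , λ K → ⇔-id _

  inInterval-zero : ∀ g → ((0ℤ , e) ≤uw (0ℤ , g)) × ¬ ((1ℤ , e) ≤uw (0ℤ , g))
  inInterval-zero g = inj₂ (inj₂ (refl , inj₂ refl)) , z≰interval g

  extend-interval : ∀ {σ : Fin n → UW} {gs} → (∀ i → σ i ≡ (0ℤ , gs i)) →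
    ∀ g i → extend U (0ℤ , g) σ i ≡ (0ℤ , extend M g gs i)
  extend-interval σ≡ g zero = refl
  extend-interval σ≡ g (suc i) = σ≡ i

  based-correct : ∀ (a b : Term Loz n) {σ g h} →
    eval U σ a ≡ (0ℤ , g) → eval U σ b ≡ (0ℤ , h) → Sat U (based a b) σ ⇔ R e g h
  based-correct a b a≡ b≡ =
    subst₂ (λ x y → ((x ≤uw y) × (x ≢ y) × (x ≢ (0ℤ , e))) ⇔ R e _ _)
           (sym a≡) (sym b≡) (⇔-sym (R-from-≤uw _ _))

  -- The quantifiers agree because the guard `inInterval` holds at every (0,g) and forces the
  -- ℤ-coordinate to be 0.
  wind-correct : ∀ (φ : Formula Lc n) {σ gs} → (∀ i → σ i ≡ (0ℤ , gs i)) →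
    Sat U (wind φ) σ ⇔ Sat M φ gs
  wind-correct (t ≐ u) σ≡
    with represent-correct t σ≡ | represent-correct u σ≡
  ... | a , a≡ , A | b , b≡ , B =
    A _ ⇔∘ B _ ⇔∘ ≡-cong-⇔ a≡ b≡ ⇔∘ ,-injective-⇔
  wind-correct (rel cycR ts) {σ} {gs} σ≡
    with represent-correct (invᶜ (ts zero) ⊗ᶜ ts (suc zero)) σ≡
       | represent-correct (invᶜ (ts zero) ⊗ᶜ ts (suc (suc zero))) σ≡
  ... | a , a≡ , A | b , b≡ , B =
    A (λ a → represent (invᶜ (ts zero) ⊗ᶜ ts (suc (suc zero))) (based a)) ⇔∘
    B (based a) ⇔∘ based-correct a b a≡ b≡ ⇔∘ ⇔-sym (R-based _ _ _)
  wind-correct ⊥f σ≡ = ⇔-id _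
  wind-correct (φ ⇒f ψ) σ≡ = →-cong-⇔ (wind-correct φ σ≡) (wind-correct ψ σ≡)
  wind-correct (φ ∧f ψ) σ≡ = wind-correct φ σ≡ ×-⇔ wind-correct ψ σ≡
  wind-correct (φ ∨f ψ) σ≡ = wind-correct φ σ≡ ⊎-⇔ wind-correct ψ σ≡
  wind-correct (∀f φ) {σ} {gs} σ≡ = mk⇔
    (λ s g → to (wind-correct φ (extend-interval σ≡ g)) (s (0ℤ , g) (inInterval-zero g)))
    back
    where
    back : (∀ g → Sat M φ (extend M g gs)) → Sat U (wind (∀f φ)) σ
    back s (k , g) (0≤ , 1≰) with interval⇒zero k g 0≤ 1≰
    ... | refl = from (wind-correct φ (extend-interval σ≡ g)) (s g)
  wind-correct (∃f φ) {σ} {gs} σ≡ = mk⇔ there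
    (λ (g , s) → (0ℤ , g) , inInterval-zero g ,
                 from (wind-correct φ (extend-interval σ≡ g)) s)
    where
    there : Sat U (wind (∃f φ)) σ → Sat M (∃f φ) gs
    there ((k , g) , (0≤ , 1≰) , s) with interval⇒zero k g 0≤ 1≰
    ... | refl = g , to (wind-correct φ (extend-interval σ≡ g)) s

-- Decision trees over the language of c.o.g.

data Tree (A : Set a) (n : ℕ) : Set a where
  leaf   : A → Tree A n
  branch : Formula Lc n → Tree A n → Tree A n → Tree A n

mapTree : {A : Set a} {B : Set b} → (A → B) → Tree A n → Tree B n
mapTree f (leaf x) = leaf (f x)
mapTree f (branch β s t) = branch β (mapTree f s) (mapTree f t)

zipTree : {A : Set a} {B : Set b} {C : Set c} →
          (A → B → C) → Tree A n → Tree B n → Tree C n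
zipTree f (leaf x) t = mapTree (f x) t
zipTree f (branch β s s′) t = branch β (zipTree f s t) (zipTree f s′ t)

-- Coordinates of terms and decomposition of formulas

IntFun : ℕ → Set
IntFun n = (Fin n → ℤ) → ℤ

IntPred : ℕ → Set₁
IntPred n = (Fin n → ℤ) → Set

-- The projection of uw(G) to G is a homomorphism that kills z, so the G-coordinate of a term is an
-- L_c-term in the G-coordinates of the variables.
residue : Term Loz n → Term Lc n
residue (var i) = var i
residue (app mulO ts) = residue (ts zero) ⊗ᶜ residue (ts (suc zero))
residue (app invO ts) = invᶜ (residue (ts zero))
residue (app oneO ts) = app oneC []
residue (app zO ts) = app oneC []

oneᶜ : Term Lc n
oneᶜ = app oneC []

cycᶠ : Term Lc n → Term Lc n → Term Lc n → Formula Lc n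
cycᶠ t u v = rel cycR (t ∷ u ∷ v ∷ [])

addᶠ : IntFun n → IntFun n → IntFun n
addᶠ f g ks = f ks +ℤ g ks

sucᶠ negᶠ neg-predᶠ : IntFun n → IntFun n
sucᶠ f ks = f ks +ℤ 1ℤ
negᶠ f ks = -ℤ f ks
neg-predᶠ f ks = -ℤ f ks +ℤ -ℤ 1ℤ

-- The questions follow the case distinctions of `_·uw_` and `invuw` in the same order, so that tree
-- and operation compute in step.
winding : Term Loz n → Tree (IntFun n) n
winding (var i) = leaf λ ks → ks i
winding (app mulO ts) =
  branch (t ≐ oneᶜ) sum
    (branch (u ≐ oneᶜ) sum
      (branch ((t ⊗ᶜ u) ≐ oneᶜ) sum+1
        (branch (cycᶠ oneᶜ t (t ⊗ᶜ u)) sum sum+1)))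
  where
  t u : Term Lc _
  t = residue (ts zero)
  u = residue (ts (suc zero))
  sum sum+1 : Tree (IntFun _) _
  sum = zipTree addᶠ (winding (ts zero)) (winding (ts (suc zero)))
  sum+1 = mapTree sucᶠ sum
winding (app invO ts) =
  branch (residue (ts zero) ≐ oneᶜ)
    (mapTree negᶠ (winding (ts zero)))
    (mapTree neg-predᶠ (winding (ts zero)))
winding (app oneO ts) = leaf λ _ → 0ℤ
winding (app zO ts) = leaf λ _ → 1ℤ

-- The formula π accumulates the answers on the branch, so that at a leaf it
-- defines the set of g that lead there.
∀-tree ∃-tree : Formula Lc (suc n) → Tree (IntPred (suc n)) (suc n) → Tree (IntPred n) n
∀-tree π (leaf P) =
  -- `P` does not see g, so g matters only through whether some g reaches this leaf. If none does,
  -- the universal statement is vacuous.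
  branch (∃f π) (leaf λ ks → ∀ k → P (k ∷ ks)) (leaf λ _ → ⊤)
∀-tree π (branch β s t) =
  zipTree (λ P Q ks → P ks × Q ks) (∀-tree (π ∧f β) s) (∀-tree (π ∧f (¬f β)) t)
∃-tree π (leaf P) =
  branch (∃f π) (leaf λ ks → Σ ℤ λ k → P (k ∷ ks)) (leaf λ _ → ⊥)
∃-tree π (branch β s t) =
  zipTree (λ P Q ks → P ks ⊎ Q ks) (∃-tree (π ∧f β) s) (∃-tree (π ∧f (¬f β)) t)

⊤f : Formula Lc n
⊤f = ¬f ⊥f

decompose : Formula Loz n → Tree (IntPred n) n
decompose (t ≐ u) =
  branch (residue t ≐ residue u)
    (zipTree (λ f g ks → f ks ≡ g ks) (winding t) (winding u))
    (leaf λ _ → ⊥)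
decompose (rel leqO ts) =
  -- The question decides the order at equal ℤ-coordinates: a positive answer leaves a weak
  -- comparison of integers, a negative one a strict comparison.
  branch ((t ≐ u) ∨f (cycᶠ oneᶜ t u ∨f (t ≐ oneᶜ)))
    (zipTree (λ f g ks → (f ks <ℤ g ks) ⊎ (f ks ≡ g ks)) p q)
    (zipTree (λ f g ks → f ks <ℤ g ks) p q)
  where
  t u : Term Lc _
  t = residue (ts zero)
  u = residue (ts (suc zero))
  p q : Tree (IntFun _) _
  p = winding (ts zero)
  q = winding (ts (suc zero))
decompose ⊥f = leaf λ _ → ⊥
decompose (φ ⇒f ψ) = zipTree (λ P Q ks → P ks → Q ks) (decompose φ) (decompose ψ)
decompose (φ ∧f ψ) = zipTree (λ P Q ks → P ks × Q ks) (decompose φ) (decompose ψ)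
decompose (φ ∨f ψ) = zipTree (λ P Q ks → P ks ⊎ Q ks) (decompose φ) (decompose ψ)
decompose (∀f φ) = ∀-tree ⊤f (decompose φ)
decompose (∃f φ) = ∃-tree ⊤f (decompose φ)

-- Evaluation of decision trees

module Run (lem : LEM) (G : COG) where
  open COG G using (Carrier)

  run : {A : Set a} → Tree A n → (Fin n → Carrier) → A
  run (leaf x) gs = x
  run (branch β s t) gs =
    if does (lem (Sat (cogStr G) β gs)) then run s gs else run t gs

  run-map : {A : Set a} {B : Set b} (f : A → B) (t : Tree A n) (gs : Fin n → Carrier) →
    run (mapTree f t) gs ≡ f (run t gs)
  run-map f (leaf x) gs = refl
  run-map f (branch β s t) gs with lem (Sat (cogStr G) β gs)
  ... | yes _ = run-map f s gs
  ... | no _  = run-map f t gs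

  run-zip : {A : Set a} {B : Set b} {C : Set c} (f : A → B → C)
    (s : Tree A n) (t : Tree B n) (gs : Fin n → Carrier) →
    run (zipTree f s t) gs ≡ f (run s gs) (run t gs)
  run-zip f (leaf x) t gs = run-map (f x) t gs
  run-zip f (branch β s s′) t gs with lem (Sat (cogStr G) β gs)
  ... | yes _ = run-zip f s t gs
  ... | no _  = run-zip f s′ t gs

-- Both groups answer every question alike, so the same leaf is reached. Its label lives in `A`,
-- which does not mention the groups.
run-elementary : (lem : LEM) (G G' : COG) {A : Set a} {gs : Fin n → COG.Carrier G}
  {gs' : Fin n → COG.Carrier G'} →
  (∀ φ → Sat (cogStr G) φ gs ⇔ Sat (cogStr G') φ gs') →
  (t : Tree A n) → Run.run lem G t gs ≡ Run.run lem G' t gs'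
run-elementary lem G G' elem (leaf x) = refl
run-elementary lem G G' {gs = gs} {gs'} elem (branch β s t)
  with lem (Sat (cogStr G) β gs) | lem (Sat (cogStr G') β gs')
... | yes _ | yes _ = run-elementary lem G G' elem s
... | no _  | no _  = run-elementary lem G G' elem t
... | yes p | no ¬p = ⊥-elim (¬p (to (elem β) p))
... | no ¬p | yes p = ⊥-elim (¬p (from (elem β) p))

-- Correctness of the decomposition

module DecomposeCorrect (lem : LEM) (G : COG) where
  open COGProperties G
  open Unwound lem G using (UW; _·uw_; invuw; _≤uw_)
  open Run lem G

  private
    M = cogStr G
    U = uwStr lem G

  Splits : (Fin n → UW) → (Fin n → ℤ) → (Fin n → Carrier) → Set
  Splits ρ ks gs = ∀ i → ρ i ≡ (ks i , gs i)

  splits-extend : ∀ {ρ : Fin n → UW} {ks gs} → Splits ρ ks gs →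
    ∀ k g → Splits (extend U (k , g) ρ) (k ∷ ks) (extend M g gs)
  splits-extend ρ≡ k g zero = refl
  splits-extend ρ≡ k g (suc i) = ρ≡ i

  eval-split : ∀ (t : Term Loz n) {ρ ks gs} → Splits ρ ks gs →
    eval U ρ t ≡ (run (winding t) gs ks , eval M gs (residue t))
  eval-split (var i) ρ≡ = ρ≡ i
  eval-split (app mulO ts) {ρ} {ks} {gs} ρ≡ =
    trans (cong₂ _·uw_ (eval-split (ts zero) ρ≡) (eval-split (ts (suc zero)) ρ≡)) product
    where
    p = winding (ts zero)
    q = winding (ts (suc zero))
    g = eval M gs (residue (ts zero))
    h = eval M gs (residue (ts (suc zero)))
    sum = zipTree addᶠ p q
    run-sum : run sum gs ks ≡ run p gs ks +ℤ run q gs ks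
    run-sum = cong-app (run-zip addᶠ p q gs) ks
    run-sum+1 : run (mapTree sucᶠ sum) gs ks ≡
                run p gs ks +ℤ run q gs ks +ℤ 1ℤ
    run-sum+1 = trans (cong-app (run-map sucᶠ sum gs) ks) (cong (_+ℤ 1ℤ) run-sum)
    product : (run p gs ks , g) ·uw (run q gs ks , h) ≡
              (run (winding (app mulO ts)) gs ks , g ∙ h)
    -- Repeating the tests of `_·uw_` unblocks the product and the tree at once, since the branch
    -- formulas unfold to these same propositions.
    product with lem (g ≡ e)
    ... | yes g≡e =
      cong₂ _,_ (sym run-sum) (sym (trans (cong (_∙ h) g≡e) (identityˡ h)))
    ... | no _ with lem (h ≡ e)
    ...   | yes h≡e =
      cong₂ _,_ (sym run-sum) (sym (trans (cong (g ∙_) h≡e) (identityʳ g)))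
    ...   | no _ with lem (g ∙ h ≡ e)
    ...     | yes gh≡e = cong₂ _,_ (sym run-sum+1) (sym gh≡e)
    ...     | no _ with lem (R e g (g ∙ h))
    ...       | yes _ = cong (_, g ∙ h) (sym run-sum)
    ...       | no _  = cong (_, g ∙ h) (sym run-sum+1)
  eval-split (app invO ts) {ρ} {ks} {gs} ρ≡ =
    trans (cong invuw (eval-split (ts zero) ρ≡)) inverse
    where
    p = winding (ts zero)
    g = eval M gs (residue (ts zero))
    inverse : invuw (run p gs ks , g) ≡ (run (winding (app invO ts)) gs ks , g ⁻¹)
    inverse with lem (g ≡ e)
    ... | yes g≡e = cong₂ _,_ (sym (cong-app (run-map negᶠ p gs) ks))
                              (sym (trans (cong _⁻¹ g≡e) ε⁻¹≈ε))
    ... | no _ = cong (_, g ⁻¹) (sym (cong-app (run-map neg-predᶠ p gs) ks))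
  eval-split (app oneO ts) ρ≡ = refl
  eval-split (app zO ts) ρ≡ = refl

  run-zip-⇔ : {A : Set a} {B : Set b} (f : A → B → IntPred n) (s : Tree A n) (t : Tree B n)
    {gs : Fin n → Carrier} {ks : Fin n → ℤ} →
    f (run s gs) (run t gs) ks ⇔ run (zipTree f s t) gs ks
  run-zip-⇔ f s t {gs} {ks} rewrite run-zip f s t gs = ⇔-id _

  -- Induction on the tree: every g satisfies `β` or its negation, so the range of g cut out by `π`
  -- is divided between the subtrees. At a leaf nothing depends on g any more, and one witness of
  -- `π` suffices.
  ∀-tree-correct : ∀ π (t : Tree (IntPred (suc n)) (suc n)) gs ks →
    (∀ g → Sat M π (extend M g gs) → ∀ k → run t (extend M g gs) (k ∷ ks))
      ⇔ run (∀-tree π t) gs ks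
  ∀-tree-correct π (leaf P) gs ks with lem (Sat M (∃f π) gs)
  ... | yes (g , p) = mk⇔ (λ s → s g p) (λ s _ _ → s)
  ... | no ¬p = mk⇔ _ (λ _ g p → ⊥-elim (¬p (g , p)))
  ∀-tree-correct π (branch β s t) gs ks =
    mk⇔ (λ f → (λ g (p , q) k → to (split g k) (f g p k) .proj₁ q) ,
               (λ g (p , ¬q) k → to (split g k) (f g p k) .proj₂ ¬q))
        (λ (f , f′) g p k → from (split g k)
           ((λ q → f g (p , q) k) , (λ ¬q → f′ g (p , ¬q) k)))
    ⇔∘ ∀-tree-correct (π ∧f β) s gs ks ×-⇔ ∀-tree-correct (π ∧f (¬f β)) t gs ks
    ⇔∘ run-zip-⇔ (λ P Q ks → P ks × Q ks) (∀-tree (π ∧f β) s) (∀-tree (π ∧f (¬f β)) t)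
    where
    split : ∀ g k → run (branch β s t) (extend M g gs) (k ∷ ks) ⇔
      ((Sat M β (extend M g gs) → run s (extend M g gs) (k ∷ ks)) ×
       (¬ Sat M β (extend M g gs) → run t (extend M g gs) (k ∷ ks)))
    split g k with lem (Sat M β (extend M g gs))
    ... | yes q = mk⇔ (λ x → (λ _ → x) , (λ ¬q → ⊥-elim (¬q q))) (λ (x , _) → x q)
    ... | no ¬q = mk⇔ (λ x → (λ q → ⊥-elim (¬q q)) , (λ _ → x)) (λ (_ , x) → x ¬q)

  -- The dual induction: a witness g falls into one of the two halves of the range, according to its
  -- answer to `β`.
  ∃-tree-correct : ∀ π (t : Tree (IntPred (suc n)) (suc n)) gs ks →
    (Σ Carrier λ g → Sat M π (extend M g gs) × Σ ℤ λ k → run t (extend M g gs) (k ∷ ks))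
      ⇔ run (∃-tree π t) gs ks
  ∃-tree-correct π (leaf P) gs ks with lem (Sat M (∃f π) gs)
  ... | yes (g , p) = mk⇔ (λ (_ , _ , s) → s) (λ s → g , p , s)
  ... | no ¬p = mk⇔ (λ (g , p , _) → ¬p (g , p)) ⊥-elim
  ∃-tree-correct π (branch β s t) gs ks =
    mk⇔ (λ (g , p , k , x) → [ (λ (q , y) → inj₁ (g , (p , q) , k , y)) ,
                               (λ (q , y) → inj₂ (g , (p , q) , k , y)) ]′ (to (split g k) x))
        [ (λ (g , (p , q) , k , y) → g , p , k , from (split g k) (inj₁ (q , y))) ,
          (λ (g , (p , q) , k , y) → g , p , k , from (split g k) (inj₂ (q , y))) ]′
    ⇔∘ ∃-tree-correct (π ∧f β) s gs ks ⊎-⇔ ∃-tree-correct (π ∧f (¬f β)) t gs ks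
    ⇔∘ run-zip-⇔ (λ P Q ks → P ks ⊎ Q ks) (∃-tree (π ∧f β) s) (∃-tree (π ∧f (¬f β)) t)
    where
    split : ∀ g k → run (branch β s t) (extend M g gs) (k ∷ ks) ⇔
      ((Sat M β (extend M g gs) × run s (extend M g gs) (k ∷ ks)) ⊎
       (¬ Sat M β (extend M g gs) × run t (extend M g gs) (k ∷ ks)))
    split g k with lem (Sat M β (extend M g gs))
    ... | yes q = mk⇔ (λ x → inj₁ (q , x)) [ proj₂ , (λ p → ⊥-elim (proj₁ p q)) ]′
    ... | no ¬q = mk⇔ (λ x → inj₂ (¬q , x)) [ (λ p → ⊥-elim (¬q (proj₁ p))) , proj₂ ]′

  -- A quantifier over uw(G) is one over g and one over k, which the tree treats separately. The
  -- initial `π` is trivially true, as no question has been asked yet.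
  decompose-correct : ∀ (φ : Formula Loz n) {ρ ks gs} → Splits ρ ks gs →
    Sat U φ ρ ⇔ run (decompose φ) gs ks
  decompose-correct (t ≐ u) {ρ} {ks} {gs} ρ≡ =
    ≡-cong-⇔ (eval-split t ρ≡) (eval-split u ρ≡) ⇔∘ pairs
    where
    pairs : ((run (winding t) gs ks , eval M gs (residue t)) ≡
             (run (winding u) gs ks , eval M gs (residue u)))
            ⇔ run (decompose (t ≐ u)) gs ks
    pairs with lem (eval M gs (residue t) ≡ eval M gs (residue u))
    ... | yes g≡h = mk⇔ (cong proj₁) (λ k≡m → cong₂ _,_ k≡m g≡h)
                    ⇔∘ run-zip-⇔ (λ f f′ ks → f ks ≡ f′ ks) (winding t) (winding u)
    ... | no g≢h = mk⇔ (g≢h ∘ cong proj₂) ⊥-elim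
  decompose-correct (rel leqO ts) {ρ} {ks} {gs} ρ≡ = order
    where
    p = winding (ts zero)
    q = winding (ts (suc zero))
    g = eval M gs (residue (ts zero))
    h = eval M gs (residue (ts (suc zero)))
    order : (eval U ρ (ts zero) ≤uw eval U ρ (ts (suc zero)))
            ⇔ run (decompose (rel leqO ts)) gs ks
    order rewrite eval-split (ts zero) ρ≡ | eval-split (ts (suc zero)) ρ≡
      with lem ((g ≡ h) ⊎ (R e g h ⊎ (g ≡ e)))
    ... | yes weak =
      mk⇔ [ inj₂ ∘ cong proj₁ , [ inj₁ , inj₂ ∘ proj₁ ]′ ]′
          [ inj₂ ∘ inj₁ ,
            (λ k≡m → [ inj₁ ∘ cong₂ _,_ k≡m , (λ r → inj₂ (inj₂ (k≡m , r))) ]′ weak) ]′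
      ⇔∘ run-zip-⇔ (λ f f′ ks → (f ks <ℤ f′ ks) ⊎ (f ks ≡ f′ ks)) p q
    ... | no ¬weak =
      mk⇔ [ ⊥-elim ∘ ¬weak ∘ inj₁ ∘ cong proj₂ ,
            [ id , ⊥-elim ∘ ¬weak ∘ inj₂ ∘ proj₂ ]′ ]′
          (inj₂ ∘ inj₁)
      ⇔∘ run-zip-⇔ (λ f f′ ks → f ks <ℤ f′ ks) p q
  decompose-correct ⊥f ρ≡ = ⇔-id _
  decompose-correct (φ ⇒f ψ) ρ≡ =
    →-cong-⇔ (decompose-correct φ ρ≡) (decompose-correct ψ ρ≡)
    ⇔∘ run-zip-⇔ (λ P Q ks → P ks → Q ks) (decompose φ) (decompose ψ)
  decompose-correct (φ ∧f ψ) ρ≡ =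
    decompose-correct φ ρ≡ ×-⇔ decompose-correct ψ ρ≡
    ⇔∘ run-zip-⇔ (λ P Q ks → P ks × Q ks) (decompose φ) (decompose ψ)
  decompose-correct (φ ∨f ψ) ρ≡ =
    decompose-correct φ ρ≡ ⊎-⇔ decompose-correct ψ ρ≡
    ⇔∘ run-zip-⇔ (λ P Q ks → P ks ⊎ Q ks) (decompose φ) (decompose ψ)
  decompose-correct (∀f φ) {ks = ks} {gs} ρ≡ =
    mk⇔ (λ f g _ k → to (decompose-correct φ (splits-extend ρ≡ k g)) (f (k , g)))
        (λ f (k , g) → from (decompose-correct φ (splits-extend ρ≡ k g)) (f g id k))
    ⇔∘ ∀-tree-correct ⊤f (decompose φ) gs ks
  decompose-correct (∃f φ) {ks = ks} {gs} ρ≡ =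
    mk⇔ (λ ((k , g) , s) → g , id , k ,
           to (decompose-correct φ (splits-extend ρ≡ k g)) s)
        (λ (g , _ , k , s) → (k , g) ,
           from (decompose-correct φ (splits-extend ρ≡ k g)) s)
    ⇔∘ ∃-tree-correct ⊤f (decompose φ) gs ks

-- Transfer between two groups

module Transfer (lem : LEM) (G G' : COG) where
  private
    U = uwStr lem G
    U' = uwStr lem G'

  wind-transfer : ∀ (φ : Formula Lc n) {σ σ' gs gs'} →
    (∀ i → σ i ≡ (0ℤ , gs i)) → (∀ i → σ' i ≡ (0ℤ , gs' i)) →
    Sat U (wind φ) σ ⇔ Sat U' (wind φ) σ' →
    Sat (cogStr G) φ gs ⇔ Sat (cogStr G') φ gs'
  wind-transfer φ σ≡ σ'≡ E =
    ⇔-sym (WindCorrect.wind-correct lem G φ σ≡) ⇔∘ E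
    ⇔∘ WindCorrect.wind-correct lem G' φ σ'≡

  -- The two assignments share their integer part `ks`. Equal answers in both groups select the same
  -- predicate, which is then applied to the same integers.
  decompose-transfer : ∀ (φ : Formula Loz n) {ρ ρ' ks gs gs'} →
    (∀ i → ρ i ≡ (ks i , gs i)) → (∀ i → ρ' i ≡ (ks i , gs' i)) →
    (∀ ψ → Sat (cogStr G) ψ gs ⇔ Sat (cogStr G') ψ gs') →
    Sat U φ ρ ⇔ Sat U' φ ρ'
  decompose-transfer φ {ks = ks} ρ≡ ρ'≡ E =
    DecomposeCorrect.decompose-correct lem G φ ρ≡
    ⇔∘ subst (λ P → _ ⇔ P ks) (run-elementary lem G G' E (decompose φ)) (⇔-id _)
    ⇔∘ ⇔-sym (DecomposeCorrect.decompose-correct lem G' φ ρ'≡)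

theorem4p1 : (lem : LEM) →
    ((G G' : COG) →
    ElemEquiv (cogStr G) (cogStr G') ⇔ ElemEquiv (uwStr lem G) (uwStr lem G'))
    ×
    ((G G' : COG) (ι : COG.Carrier G → COG.Carrier G') → IsCOGEmbedding G G' ι →
    IsElementary (cogStr G) (cogStr G') ι
    ⇔ IsElementary (uwStr lem G) (uwStr lem G') (uwMap G G' ι))
theorem4p1 lem = equivalence , inclusion
  where
  equivalence : (G G' : COG) →
    ElemEquiv (cogStr G) (cogStr G') ⇔ ElemEquiv (uwStr lem G) (uwStr lem G')
  equivalence G G' = mk⇔
    (λ E φ → decompose-transfer φ {ks = noVars} (λ ()) (λ ()) E)
    (λ E φ → wind-transfer φ (λ ()) (λ ()) (E (wind φ)))
    where open Transfer lem G G'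

  inclusion : (G G' : COG) (ι : COG.Carrier G → COG.Carrier G') → IsCOGEmbedding G G' ι →
    IsElementary (cogStr G) (cogStr G') ι
    ⇔ IsElementary (uwStr lem G) (uwStr lem G') (uwMap G G' ι)
  inclusion G G' ι _ = mk⇔
    -- `uwMap` fixes ℤ-coordinates, so `ρ` and its image have the same integer part.
    (λ E {_} φ ρ → decompose-transfer φ {ks = proj₁ ∘ ρ} (λ _ → refl) (λ _ → refl)
                 (λ ψ → E ψ (proj₂ ∘ ρ)))
    -- Elements of G are tested through their codes (0,g), which `uwMap` sends to the codes of their
    -- images.
    (λ E {_} φ gs → wind-transfer φ (λ _ → refl) (λ _ → refl)
                  (E (wind φ) (λ i → 0ℤ , gs i)))
    where open Transfer lem G G'
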